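{- For any graphs $G$ and $H$, $$\rho_e^o(G)\,\alpha(H)\le \rho_e^o(G\circ H)\le \rho_e^o(G)\,\alpha(H)+\rho_e^o(H)\bigl(\alpha(G)-\rho_e^o(G)\bigr).$$ These bounds are sharp, that is, each of the two inequalities is attained with equality by some graphs $G$ and $H$.
   Context: All graphs are finite and simple. A set $B\subseteq E(G)$ is an edge open packing set (EOP set) of $G$ if for any two distinct edges $e_1,e_2\in B$ there is no edge $e\in E(G)\setminus\{e_1,e_2\}$ joining an endvertex of $e_1$ to an endvertex of $e_2$ (that is, no edge $e$ such that $e_1,e,e_2$ form a path with middle edge $e$ or a triangle). Edges of $B$ may share an endvertex. The maximum cardinality of an EOP set is the EOP number $\rho_e^o(G)$. $\alpha(G)$ is the independence number of $G$. The lexicographic product $G\circ H$ has vertex set $V(G)\times V(H)$, and $(g,h)$, $(g',h')$ are adjacent if either $gg'\in E(G)$, or $g=g'$ and $hh'\in E(H)$. -}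

module Defs where

open import Data.List.Base using (List; []; _∷_; _++_; map; filter; length; cartesianProduct)
open import Data.List.Extrema.Nat using (max)
open import Data.List.Membership.Propositional using (_∈_)
open import Data.List.Membership.Propositional.Properties using (∈-cartesianProduct⁺)
open import Data.List.Relation.Unary.All using (All; all?)
open import Data.List.Relation.Unary.Any using (Any; any?)
open import Data.List.Relation.Unary.Unique.Propositional using (Unique)
open import Data.List.Relation.Unary.Unique.Propositional.Properties using (cartesianProduct⁺)
open import Data.Nat.Base using (ℕ)
open import Data.Product.Base using (_×_; _,_; proj₁; proj₂)
open import Data.Product.Properties using (≡-dec)
open import Data.Sum.Base using (_⊎_; inj₁; inj₂)
open import Level using (0ℓ)
open import Relation.Binary.Core using (Rel)
open import Relation.Binary.Definitions using (Decidable; DecidableEquality; Symmetric)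
open import Relation.Binary.PropositionalEquality using (_≡_; _≢_; sym)
open import Relation.Nullary.Decidable using (_×-dec_; _⊎-dec_; _→-dec_; ¬?)
open import Relation.Nullary.Negation using (¬_)
import Relation.Unary as U

private
  variable
    A : Set

-- Finite simple graphs. Adjacency is decidable, so that maxima over finite
-- families of vertex or edge sets can be computed. The graph without vertices
-- is allowed.
record Graph : Set₁ where
  infix 4 _~_ _≟_ _~?_
  field
    Vertex   : Set
    vertices : List Vertex
    unique   : Unique vertices
    complete : ∀ v → v ∈ vertices
    _≟_      : DecidableEquality Vertex
    _~_      : Rel Vertex 0ℓ
    _~?_     : Decidable _~_
    ~-sym    : Symmetric _~_
    ~-irrefl : ∀ {v} → ¬ (v ~ v)

-- All subsequences of a list. If the list has no repetitions, these represent
-- each subset of its elements exactly once, with cardinality given by length.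
subsets : List A → List (List A)
subsets []       = [] ∷ []
subsets (x ∷ xs) = subsets xs ++ map (x ∷_) (subsets xs)

-- All pairs (x , y) such that x occurs before y. If the list has no
-- repetitions, these represent each two-element subset exactly once.
unorderedPairs : List A → List (A × A)
unorderedPairs []       = []
unorderedPairs (x ∷ xs) = map (x ,_) xs ++ unorderedPairs xs

-- The default value 0 only matters when no subset satisfies P; this does not
-- occur below, as the empty set is always independent and edge open packing.
maxCardinality : {P : U.Pred (List A) 0ℓ} → U.Decidable P → List A → ℕ
maxCardinality P? xs = max 0 (map length (filter P? (subsets xs)))

module _ (G : Graph) where
  open Graph G

  -- Each edge {u , v} occurs in exactly one of its two orientations, so
  -- propositional equality of elements of this list is equality of edges.
  edges : List (Vertex × Vertex)
  edges = filter (λ e → proj₁ e ~? proj₂ e) (unorderedPairs vertices)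

  Independent : List Vertex → Set
  Independent S = All (λ u → All (λ v → ¬ (u ~ v)) S) S

  independent? : U.Decidable Independent
  independent? S = all? (λ u → all? (λ v → ¬? (u ~? v)) S) S

  α : ℕ
  α = maxCardinality independent? vertices

  EndOf : Vertex → Vertex × Vertex → Set
  EndOf w (u , v) = w ≡ u ⊎ w ≡ v

  Joins : Vertex × Vertex → Vertex × Vertex → Vertex × Vertex → Set
  Joins (u , v) e₁ e₂ = (EndOf u e₁ × EndOf v e₂) ⊎ (EndOf v e₁ × EndOf u e₂)

  EdgeOpenPacking : List (Vertex × Vertex) → Set
  EdgeOpenPacking B =
    All (λ e₁ → All (λ e₂ → e₁ ≢ e₂ →
      ¬ Any (λ e → e ≢ e₁ × e ≢ e₂ × Joins e e₁ e₂) edges) B) B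

  endOf? : Decidable EndOf
  endOf? w (u , v) = (w ≟ u) ⊎-dec (w ≟ v)

  joins? : ∀ e → Decidable (Joins e)
  joins? (u , v) e₁ e₂ =
    (endOf? u e₁ ×-dec endOf? v e₂) ⊎-dec (endOf? v e₁ ×-dec endOf? u e₂)

  edgeOpenPacking? : U.Decidable EdgeOpenPacking
  edgeOpenPacking? B =
    all? (λ e₁ → all? (λ e₂ → ¬? (e₁ ≟ᵉ e₂) →-dec
      ¬? (any? (λ e → ¬? (e ≟ᵉ e₁) ×-dec ¬? (e ≟ᵉ e₂) ×-dec joins? e e₁ e₂) edges)) B) B
    where
    _≟ᵉ_ : DecidableEquality (Vertex × Vertex)
    _≟ᵉ_ = ≡-dec _≟_ _≟_

  ρᵉᵒ : ℕ
  ρᵉᵒ = maxCardinality edgeOpenPacking? edges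

infixr 9 _∘ˡ_

-- The lexicographic product.
_∘ˡ_ : Graph → Graph → Graph
G ∘ˡ H = record
  { Vertex   = G.Vertex × H.Vertex
  ; vertices = cartesianProduct G.vertices H.vertices
  ; unique   = cartesianProduct⁺ G.unique H.unique
  ; complete = λ (g , h) → ∈-cartesianProduct⁺ (G.complete g) (H.complete h)
  ; _≟_      = ≡-dec G._≟_ H._≟_
  ; _~_      = λ (g , h) (g′ , h′) → g G.~ g′ ⊎ (g ≡ g′ × h H.~ h′)
  ; _~?_     = λ (g , h) (g′ , h′) → (g G.~? g′) ⊎-dec ((g G.≟ g′) ×-dec (h H.~? h′))
  ; ~-sym    = λ { (inj₁ p)       → inj₁ (G.~-sym p)
                 ; (inj₂ (p , q)) → inj₂ (sym p , H.~-sym q) }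
  ; ~-irrefl = λ { (inj₁ p)       → G.~-irrefl p
                 ; (inj₂ (_ , q)) → H.~-irrefl q }
  }
  where
  module G = Graph G
  module H = Graph H

{-# OPTIONS --safe #-}

-- An edge open packing set is the edge set of an induced star forest without
-- isolated vertices. Orienting every edge from a leaf to the centre of its
-- star, such a forest in G ∘ H is projected to G. All darts over a given dart
-- of G have the same type: either the projected dart is an edge of G, and then
-- the leaves above it are independent in H, or it is degenerate, and then the
-- darts above it form a star forest of H. The nondegenerate projections form a
-- star forest of G, and all the projected leaves together are independent in G.
module Submission where

open import Defs
open import Data.Bool.Base using (Bool; true; false)
import Data.Bool.Properties as Bool
open import Data.Empty using (⊥-elim)
open import Data.Integer.Base using (+_; _+_; _-_; _*_; _≤_)
import Data.Integer.Base as ℤ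
import Data.Integer.Properties as ℤ
open import Data.List.Base
  using (List; []; _∷_; _++_; map; filter; length; concatMap; cartesianProduct; deduplicate)
open import Data.List.Extrema.Nat using (argmax-sel; v≤max⁺)
open import Data.List.Membership.Propositional using (_∈_; _∉_; lose; find)
open import Data.List.Membership.Propositional.Properties
open import Data.List.Properties using (length-++; length-++-sucʳ; length-map)
open import Data.List.Relation.Binary.Disjoint.Propositional using (Disjoint)
open import Data.List.Relation.Binary.Subset.Propositional using (_⊆_)
open import Data.List.Relation.Unary.All as All using (All; []; _∷_)
open import Data.List.Relation.Unary.AllPairs using ([]; _∷_)
open import Data.List.Relation.Unary.Any using (Any; here; there; any?)
open import Data.List.Relation.Unary.Unique.Propositional using (Unique)
open import Data.List.Relation.Unary.Unique.Propositional.Properties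
  using (map⁺; ++⁺; filter⁺; cartesianProduct⁺; Unique[x∷xs]⇒x∉xs)
import Data.List.Relation.Unary.Unique.DecPropositional.Properties as DecUnique
import Data.List.Membership.DecPropositional as DecMembership
open import Data.Nat.Base as ℕ using (ℕ; suc; z≤n; s≤s; _∸_)
import Data.Nat.Properties as ℕ
open import Data.Product.Base using (_×_; ∃; ∃₂; _,_; proj₁; proj₂; swap)
open import Data.Product.Properties using (≡-dec)
open import Data.Sum.Base as Sum using (_⊎_; inj₁; inj₂)
open import Function.Base using (_∘_; id)
open import Level using (0ℓ)
open import Relation.Binary.Core using (Rel)
open import Relation.Binary.Definitions using (DecidableEquality)
open import Relation.Binary.PropositionalEquality
  using (_≡_; _≢_; refl; sym; trans; cong; cong₂; subst; subst₂)
open import Relation.Nullary.Decidable using (yes; no; _×-dec_; ¬?)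
open import Relation.Nullary.Negation using (¬_; contradiction)
import Relation.Unary as U

private
  variable
    A B : Set

-- Membership in mapped lists.

∈-map-elim : {f : A → B} {xs : List A} {P : U.Pred B 0ℓ} →
  (∀ {x} → x ∈ xs → P (f x)) → ∀ {y} → y ∈ map f xs → P y
∈-map-elim {f = f} h y∈ with ∈-map⁻ f y∈
... | _ , x∈ , refl = h x∈

∈-map-elim₂ : {f : A → B} {xs : List A} {R : Rel B 0ℓ} →
  (∀ {x x′} → x ∈ xs → x′ ∈ xs → R (f x) (f x′)) →
  ∀ {y y′} → y ∈ map f xs → y′ ∈ map f xs → R y y′
∈-map-elim₂ h y∈ y′∈ = ∈-map-elim (λ x∈ → ∈-map-elim (λ x′∈ → h x∈ x′∈) y′∈) y∈

-- Repetition-free lists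

-- Injectivity is asked only on members of the list: `orient`, `dart` and the passage to leaves are
-- injective only on a star forest or packing.
Unique-map⁺ : {f : A → B} {xs : List A} →
  (∀ {x y} → x ∈ xs → y ∈ xs → f x ≡ f y → x ≡ y) → Unique xs → Unique (map f xs)
Unique-map⁺ inj []       = []
Unique-map⁺ {f = f} inj (x∉ ∷ u) =
  All.tabulate (λ z∈ fx≡z → let y , y∈ , z≡fy = ∈-map⁻ f z∈ in
    All.lookup x∉ y∈ (inj (here refl) (there y∈) (trans fx≡z z≡fy)))
  ∷ Unique-map⁺ (λ x∈ y∈ → inj (there x∈) (there y∈)) u

-- Pigeonhole: delete one occurrence of the head from `ys`; the tail does not contain the head, so
-- it still lies in what remains.
Unique-⊆⇒length≤ : {xs ys : List A} → Unique xs → xs ⊆ ys → length xs ℕ.≤ length ys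
Unique-⊆⇒length≤ []       _ = z≤n
Unique-⊆⇒length≤ {xs = x ∷ xs} (x∉ ∷ u) xs⊆ with ∈-∃++ (xs⊆ (here refl))
... | as , bs , refl = subst (suc (length xs) ℕ.≤_) (sym (length-++-sucʳ as x bs))
  (s≤s (Unique-⊆⇒length≤ u (λ z∈ → delete z∈ (∈-++⁻ as (xs⊆ (there z∈))))))
  where
  delete : ∀ {z} → z ∈ xs → z ∈ as ⊎ z ∈ x ∷ bs → z ∈ as ++ bs
  delete _  (inj₁ z∈)           = ∈-++⁺ˡ z∈
  delete z∈ (inj₂ (here refl))  = contradiction refl (All.lookup x∉ z∈)
  delete _  (inj₂ (there z∈))   = ∈-++⁺ʳ as z∈

length-concatMap≤ : (f : A → List B) {n : ℕ} (xs : List A) →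
  (∀ {x} → x ∈ xs → length (f x) ℕ.≤ n) → length (concatMap f xs) ℕ.≤ length xs ℕ.* n
length-concatMap≤ f     []       _ = z≤n
length-concatMap≤ f {n} (x ∷ xs) h = subst (ℕ._≤ n ℕ.+ length xs ℕ.* n) (sym (length-++ (f x)))
  (ℕ.+-mono-≤ (h (here refl)) (length-concatMap≤ f xs (h ∘ there)))

length-filter-∁ : {P : U.Pred A 0ℓ} (P? : U.Decidable P) (xs : List A) →
  length (filter P? xs) ℕ.+ length (filter (¬? ∘ P?) xs) ≡ length xs
length-filter-∁ P? []       = refl
length-filter-∁ P? (x ∷ xs) with P? x
... | yes _ = cong suc (length-filter-∁ P? xs)
... | no  _ = trans (ℕ.+-suc _ _) (cong suc (length-filter-∁ P? xs))

module _ (_≟_ : DecidableEquality B) (f : A → B) where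

  fibre : List A → B → List A
  fibre xs y = filter (λ x → f x ≟ y) xs

  -- The fibres over `ys` cover `xs`, so pigeonhole bounds its length by the sum of theirs.
  length≤fibres : {P : U.Pred B 0ℓ} (P? : U.Decidable P) {xs : List A} {ys : List B} {m n : ℕ} →
    Unique xs → (∀ {x} → x ∈ xs → f x ∈ ys) →
    (∀ {y} → P y → length (fibre xs y) ℕ.≤ m) →
    (∀ {y} → ¬ P y → length (fibre xs y) ℕ.≤ n) →
    length xs ℕ.≤ length (filter P? ys) ℕ.* m ℕ.+ length (filter (¬? ∘ P?) ys) ℕ.* n
  length≤fibres {P} P? {xs} {ys} u f∈ ≤m ≤n = begin
    length xs
      ≤⟨ Unique-⊆⇒length≤ u cover ⟩
    length (concatMap (fibre xs) ysP ++ concatMap (fibre xs) ys∁)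
      ≡⟨ length-++ (concatMap (fibre xs) ysP) ⟩
    length (concatMap (fibre xs) ysP) ℕ.+ length (concatMap (fibre xs) ys∁)
      ≤⟨ ℕ.+-mono-≤
           (length-concatMap≤ (fibre xs) ysP (≤m ∘ proj₂ ∘ ∈-filter⁻ P? {xs = ys}))
           (length-concatMap≤ (fibre xs) ys∁ (≤n ∘ proj₂ ∘ ∈-filter⁻ (¬? ∘ P?) {xs = ys})) ⟩
    length ysP ℕ.* _ ℕ.+ length ys∁ ℕ.* _ ∎
    where
    open ℕ.≤-Reasoning
    ysP = filter P? ys
    ys∁ = filter (¬? ∘ P?) ys

    cover : xs ⊆ concatMap (fibre xs) ysP ++ concatMap (fibre xs) ys∁
    cover {x} x∈ with P? (f x)
    ... | yes p = ∈-++⁺ˡ (∈-concatMap⁺ (fibre xs)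
      (lose (∈-filter⁺ P? (f∈ x∈) p) (∈-filter⁺ (λ x → f x ≟ _) x∈ refl)))
    ... | no ¬p = ∈-++⁺ʳ (concatMap (fibre xs) ysP) (∈-concatMap⁺ (fibre xs)
      (lose (∈-filter⁺ (¬? ∘ P?) (f∈ x∈) ¬p) (∈-filter⁺ (λ x → f x ≟ _) x∈ refl)))

-- Subsets of maximum cardinality

[]∈subsets : (xs : List A) → [] ∈ subsets xs
[]∈subsets []       = here refl
[]∈subsets (x ∷ xs) = ∈-++⁺ˡ ([]∈subsets xs)

filter∈subsets : {P : U.Pred A 0ℓ} (P? : U.Decidable P) (xs : List A) → filter P? xs ∈ subsets xs
filter∈subsets P? []       = here refl
filter∈subsets P? (x ∷ xs) with P? x
... | yes _ = ∈-++⁺ʳ (subsets xs) (∈-map⁺ (x ∷_) (filter∈subsets P? xs))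
... | no  _ = ∈-++⁺ˡ (filter∈subsets P? xs)

∈subsets⇒⊆ : (xs : List A) {S : List A} → S ∈ subsets xs → S ⊆ xs
∈subsets⇒⊆ []       (here refl) = id
∈subsets⇒⊆ (x ∷ xs) S∈ with ∈-++⁻ (subsets xs) S∈
... | inj₁ S∈′ = there ∘ ∈subsets⇒⊆ xs S∈′
... | inj₂ S∈′ with ∈-map⁻ (x ∷_) S∈′
...   | T , T∈ , refl = λ { (here refl) → here refl ; (there z∈) → there (∈subsets⇒⊆ xs T∈ z∈) }

∈subsets⇒Unique : {xs : List A} {S : List A} → Unique xs → S ∈ subsets xs → Unique S
∈subsets⇒Unique {xs = []}     u (here refl) = []
∈subsets⇒Unique {xs = x ∷ xs} (x∉ ∷ u) S∈ with ∈-++⁻ (subsets xs) S∈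
... | inj₁ S∈′ = ∈subsets⇒Unique u S∈′
... | inj₂ S∈′ with ∈-map⁻ (x ∷_) S∈′
...   | T , T∈ , refl = All.tabulate (All.lookup x∉ ∘ ∈subsets⇒⊆ xs T∈) ∷ ∈subsets⇒Unique u T∈

-- Independence and edge open packing are both conditions on pairs of members, so one treatment
-- serves `α` and `ρᵉᵒ`.
module _ {R : Rel A 0ℓ} (P? : U.Decidable (λ S → All (λ x → All (R x) S) S)) {xs : List A} where

  maxCardinality-attained : Unique xs → ∃ λ S →
    Unique S × S ⊆ xs × (∀ {x y} → x ∈ S → y ∈ S → R x y) × length S ≡ maxCardinality P? xs
  maxCardinality-attained u
    with argmax-sel id 0 (map length (filter P? (subsets xs)))
  -- The maximum may be the default 0, which the empty set attains.
  ... | inj₁ ≡0 = [] , [] , (λ ()) , (λ ()) , sym ≡0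
  ... | inj₂ ∈lengths with ∈-map⁻ length ∈lengths
  ...   | S , S∈ , eq with ∈-filter⁻ P? {xs = subsets xs} S∈
  ...     | S∈′ , PS = S , ∈subsets⇒Unique u S∈′ , ∈subsets⇒⊆ xs S∈′ ,
    (λ x∈ y∈ → All.lookup (All.lookup PS x∈) y∈) , sym eq

  -- `S` may list its elements in another order than `xs`; filtering `xs` by membership in `S` gives
  -- a representative among the subsets.
  length≤maxCardinality : DecidableEquality A → ∀ {S} →
    Unique S → S ⊆ xs → (∀ {x y} → x ∈ S → y ∈ S → R x y) → length S ℕ.≤ maxCardinality P? xs
  length≤maxCardinality _≟_ {S} u S⊆ r = ℕ.≤-trans
    (Unique-⊆⇒length≤ u (λ x∈ → ∈-filter⁺ (_∈? S) (S⊆ x∈) x∈))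
    (v≤max⁺ 0 (map length (filter P? (subsets xs))) (inj₂ (lose
      (∈-map⁺ length (∈-filter⁺ P? (filter∈subsets (_∈? S) xs)
        (All.tabulate (λ x∈ → All.tabulate (λ y∈ → r (⊆S x∈) (⊆S y∈))))))
      ℕ.≤-refl)))
    where
    open DecMembership _≟_ using (_∈?_)
    ⊆S : filter (_∈? S) xs ⊆ S
    ⊆S = proj₂ ∘ ∈-filter⁻ (_∈? S) {xs = xs}

-- Unordered pairs

unorderedPairs⁺ : ∀ {xs : List A} {x y} → x ≢ y → x ∈ xs → y ∈ xs →
  (x , y) ∈ unorderedPairs xs ⊎ (y , x) ∈ unorderedPairs xs
unorderedPairs⁺ x≢y (here refl) (here refl) = contradiction refl x≢y
unorderedPairs⁺ x≢y (here refl) (there y∈)  = inj₁ (∈-++⁺ˡ (∈-map⁺ (_ ,_) y∈))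
unorderedPairs⁺ x≢y (there x∈)  (here refl) = inj₂ (∈-++⁺ˡ (∈-map⁺ (_ ,_) x∈))
unorderedPairs⁺ {xs = z ∷ xs} x≢y (there x∈) (there y∈) =
  Sum.map (∈-++⁺ʳ (map (z ,_) xs)) (∈-++⁺ʳ (map (z ,_) xs)) (unorderedPairs⁺ x≢y x∈ y∈)

unorderedPairs-∷⁻ : ∀ {x y z : A} {xs} → (x , y) ∈ unorderedPairs (z ∷ xs) →
  (x ≡ z × y ∈ xs) ⊎ (x , y) ∈ unorderedPairs xs
unorderedPairs-∷⁻ {z = z} {xs} p with ∈-++⁻ (map (z ,_) xs) p
... | inj₂ p′ = inj₂ p′
... | inj₁ p′ with ∈-map⁻ (z ,_) p′
...   | _ , y∈ , refl = inj₁ (refl , y∈)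

unorderedPairs⁻ : ∀ {xs : List A} {x y} → (x , y) ∈ unorderedPairs xs → x ∈ xs × y ∈ xs
unorderedPairs⁻ {xs = z ∷ xs} p with unorderedPairs-∷⁻ {xs = xs} p
... | inj₁ (refl , y∈) = here refl , there y∈
... | inj₂ p′          = let x∈ , y∈ = unorderedPairs⁻ p′ in there x∈ , there y∈

unorderedPairs-asym : ∀ {xs : List A} {x y} → Unique xs →
  (x , y) ∈ unorderedPairs xs → (y , x) ∉ unorderedPairs xs
unorderedPairs-asym {xs = z ∷ xs} u@(_ ∷ u′) p q
  with unorderedPairs-∷⁻ {xs = xs} p | unorderedPairs-∷⁻ {xs = xs} q
... | inj₁ (refl , y∈) | inj₁ (refl , _)  = Unique[x∷xs]⇒x∉xs u y∈
... | inj₁ (refl , _)  | inj₂ q′          = Unique[x∷xs]⇒x∉xs u (proj₂ (unorderedPairs⁻ q′))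
... | inj₂ p′          | inj₁ (refl , _)  = Unique[x∷xs]⇒x∉xs u (proj₂ (unorderedPairs⁻ p′))
... | inj₂ p′          | inj₂ q′          = unorderedPairs-asym u′ p′ q′

unorderedPairs-Unique : {xs : List A} → Unique xs → Unique (unorderedPairs xs)
unorderedPairs-Unique []                = []
unorderedPairs-Unique {xs = z ∷ xs} u@(_ ∷ u′) =
  ++⁺ (map⁺ (cong proj₂) u′) (unorderedPairs-Unique u′) disjoint
  where
  disjoint : Disjoint (map (z ,_) xs) (unorderedPairs xs)
  disjoint (p , q) with ∈-map⁻ (z ,_) p
  ... | _ , _ , refl = Unique[x∷xs]⇒x∉xs u (proj₁ (unorderedPairs⁻ q))

infix 4 _≈ˢ_

-- Equality of the underlying undirected edges.
_≈ˢ_ : Rel (A × A) 0ℓ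
p ≈ˢ q = p ≡ q ⊎ p ≡ swap q

≈ˢ-swapˡ : {p q : A × A} → p ≈ˢ q → swap p ≈ˢ q
≈ˢ-swapˡ (inj₁ refl) = inj₂ refl
≈ˢ-swapˡ (inj₂ refl) = inj₁ refl

≈ˢ-sym : {p q : A × A} → p ≈ˢ q → q ≈ˢ p
≈ˢ-sym (inj₁ refl) = inj₁ refl
≈ˢ-sym (inj₂ refl) = inj₂ refl

≈ˢ-trans : {p q r : A × A} → p ≈ˢ q → q ≈ˢ r → p ≈ˢ r
≈ˢ-trans (inj₁ refl) s           = s
≈ˢ-trans (inj₂ refl) (inj₁ refl) = inj₂ refl
≈ˢ-trans (inj₂ refl) (inj₂ refl) = inj₁ refl

-- Star forests as lists of darts (leaf , centre)

module _ (G : Graph) where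
  open Graph G

  Dart : Set
  Dart = Vertex × Vertex

  -- Together the fields say that the only edges of `G` among the ends of `D` are the spokes: a leaf
  -- sees no centre but its own. A star with one edge may have either end as its centre.
  record StarForest (D : List Dart) : Set where
    field
      spoke        : ∀ {p} → p ∈ D → proj₁ p ~ proj₂ p
      leaves       : ∀ {p q} → p ∈ D → q ∈ D → ¬ (proj₁ p ~ proj₁ q)
      centres      : ∀ {p q} → p ∈ D → q ∈ D → ¬ (proj₂ p ~ proj₂ q)
      spoke⇒centre : ∀ {p q} → p ∈ D → q ∈ D → proj₁ p ~ proj₂ q → proj₂ p ≡ proj₂ q

    -- A common leaf is adjacent to both centres, so these agree.
    leaf-injective : ∀ {p q} → p ∈ D → q ∈ D → proj₁ p ≡ proj₁ q → p ≡ q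
    leaf-injective p∈ q∈ eq =
      cong₂ _,_ eq (spoke⇒centre p∈ q∈ (subst (_~ _) (sym eq) (spoke q∈)))

  _≟ᵈ_ : DecidableEquality Dart
  _≟ᵈ_ = ≡-dec _≟_ _≟_

  ~⇒≢ : ∀ {u v} → u ~ v → u ≢ v
  ~⇒≢ u~v refl = ~-irrefl u~v

  length≤α : ∀ {S} → Unique S → (∀ {u v} → u ∈ S → v ∈ S → ¬ (u ~ v)) → length S ℕ.≤ α G
  length≤α u = length≤maxCardinality (independent? G) _≟_ u (λ _ → complete _)

  α-attained : ∃ λ S → Unique S × (∀ {u v} → u ∈ S → v ∈ S → ¬ (u ~ v)) × length S ≡ α G
  α-attained with maxCardinality-attained (independent? G) unique
  ... | S , u , _ , ind , eq = S , u , ind , eq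

  edges-Unique : Unique (edges G)
  edges-Unique = filter⁺ _ (unorderedPairs-Unique unique)

  edge⇒~ : ∀ {u v} → (u , v) ∈ edges G → u ~ v
  edge⇒~ = proj₂ ∘ ∈-filter⁻ (λ e → proj₁ e ~? proj₂ e) {xs = unorderedPairs vertices}

  ≈ˢ-edges⇒≡ : ∀ {e f} → e ∈ edges G → f ∈ edges G → e ≈ˢ f → e ≡ f
  ≈ˢ-edges⇒≡ e∈ f∈ (inj₁ eq)   = eq
  ≈ˢ-edges⇒≡ e∈ f∈ (inj₂ refl) = ⊥-elim (unorderedPairs-asym unique
    (proj₁ (∈-filter⁻ (λ e → proj₁ e ~? proj₂ e) f∈))
    (proj₁ (∈-filter⁻ (λ e → proj₁ e ~? proj₂ e) e∈)))

  ~⇒edge : ∀ {u v} → u ~ v → ∃ λ e → e ∈ edges G × e ≈ˢ (u , v)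
  ~⇒edge u~v with unorderedPairs⁺ (~⇒≢ u~v) (complete _) (complete _)
  ... | inj₁ uv = _ , ∈-filter⁺ _ uv u~v , inj₁ refl
  ... | inj₂ vu = _ , ∈-filter⁺ _ vu (~-sym u~v) , inj₂ refl

  EndOf-≈ˢ : ∀ {e f w} → e ≈ˢ f → EndOf G w e → EndOf G w f
  EndOf-≈ˢ (inj₁ refl) = id
  EndOf-≈ˢ (inj₂ refl) = Sum.swap

  ends⇒≈ˢ : ∀ {u v e} → u ≢ v → EndOf G u e → EndOf G v e → (u , v) ≈ˢ e
  ends⇒≈ˢ u≢v (inj₁ refl) (inj₁ refl) = contradiction refl u≢v
  ends⇒≈ˢ u≢v (inj₁ refl) (inj₂ refl) = inj₁ refl
  ends⇒≈ˢ u≢v (inj₂ refl) (inj₁ refl) = inj₂ refl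
  ends⇒≈ˢ u≢v (inj₂ refl) (inj₂ refl) = contradiction refl u≢v

  -- From star forests to edge open packing sets.

  module FromStarForest {D : List Dart} (uD : Unique D) (F : StarForest D) where
    open StarForest F
    open DecMembership _≟ᵈ_ using (_∈?_)

    -- `edges G` lists one orientation of each edge, not necessarily the one from leaf to centre.
    orient : Dart → Dart
    orient p with p ∈? edges G
    ... | yes _ = p
    ... | no  _ = swap p

    orient-≈ˢ : ∀ p → orient p ≈ˢ p
    orient-≈ˢ p with p ∈? edges G
    ... | yes _ = inj₁ refl
    ... | no  _ = inj₂ refl

    orient-edge : ∀ {p} → p ∈ D → orient p ∈ edges G
    orient-edge {p} p∈ with p ∈? edges G
    ... | yes p∈E = p∈E
    ... | no  p∉E with ~⇒edge (spoke p∈)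
    ...   | _ , e∈ , inj₁ refl = contradiction e∈ p∉E
    ...   | _ , e∈ , inj₂ refl = e∈

    orient-injective : ∀ {p q} → p ∈ D → q ∈ D → orient p ≡ orient q → p ≡ q
    orient-injective {p} {q} p∈ q∈ eq
      with ≈ˢ-trans (≈ˢ-sym (orient-≈ˢ p)) (subst (_≈ˢ q) (sym eq) (orient-≈ˢ q))
    ... | inj₁ p≡q  = p≡q
    -- If `p` were the reverse of `q`, its spoke would join two leaves.
    ... | inj₂ refl = contradiction (spoke p∈) (leaves p∈ q∈)

    -- Leaf and leaf, or centre and centre, are never adjacent; a leaf and a centre are adjacent
    -- only along the spoke of that leaf.
    adjacent-ends : ∀ {p q u v} → p ∈ D → q ∈ D → EndOf G u p → EndOf G v q → u ~ v →
      (u , v) ≈ˢ p ⊎ (u , v) ≈ˢ q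
    adjacent-ends p∈ q∈ (inj₁ refl) (inj₁ refl) u~v = contradiction u~v (leaves p∈ q∈)
    adjacent-ends p∈ q∈ (inj₁ refl) (inj₂ refl) u~v =
      inj₁ (inj₁ (cong (_ ,_) (sym (spoke⇒centre p∈ q∈ u~v))))
    adjacent-ends p∈ q∈ (inj₂ refl) (inj₁ refl) u~v =
      inj₂ (inj₂ (cong (_, _) (sym (spoke⇒centre q∈ p∈ (~-sym u~v)))))
    adjacent-ends p∈ q∈ (inj₂ refl) (inj₂ refl) u~v = contradiction u~v (centres p∈ q∈)

    joins⇒≡ : ∀ {p q e} → p ∈ D → q ∈ D → e ∈ edges G → Joins G e (orient p) (orient q) →
      e ≡ orient p ⊎ e ≡ orient q
    joins⇒≡ {p} {q} {e} p∈ q∈ e∈ = λ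
      { (inj₁ (u , v)) → conclude (ends u v (edge⇒~ e∈))
      ; (inj₂ (v , u)) → conclude (Sum.map ≈ˢ-swapˡ ≈ˢ-swapˡ (ends v u (~-sym (edge⇒~ e∈))))
      }
      where
      ends : ∀ {u v} → EndOf G u (orient p) → EndOf G v (orient q) → u ~ v →
        (u , v) ≈ˢ p ⊎ (u , v) ≈ˢ q
      ends u v = adjacent-ends p∈ q∈ (EndOf-≈ˢ (orient-≈ˢ p) u) (EndOf-≈ˢ (orient-≈ˢ q) v)

      same : ∀ {r} → r ∈ D → e ≈ˢ r → e ≡ orient r
      same {r} r∈ s = ≈ˢ-edges⇒≡ e∈ (orient-edge r∈) (≈ˢ-trans s (≈ˢ-sym (orient-≈ˢ r)))

      conclude : e ≈ˢ p ⊎ e ≈ˢ q → e ≡ orient p ⊎ e ≡ orient q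
      conclude = Sum.map (same p∈) (same q∈)

    length≤ρᵉᵒ : length D ℕ.≤ ρᵉᵒ G
    length≤ρᵉᵒ = subst (ℕ._≤ ρᵉᵒ G) (length-map orient D)
      (length≤maxCardinality (edgeOpenPacking? G) _≟ᵈ_ (Unique-map⁺ orient-injective uD) orient⊆ packing)
      where
      orient⊆ : map orient D ⊆ edges G
      orient⊆ e∈ with ∈-map⁻ orient e∈
      ... | _ , p∈ , refl = orient-edge p∈

      packing : ∀ {e₁ e₂} → e₁ ∈ map orient D → e₂ ∈ map orient D → e₁ ≢ e₂ →
        ¬ Any (λ e → e ≢ e₁ × e ≢ e₂ × Joins G e e₁ e₂) (edges G)
      packing e₁∈ e₂∈ _ joined with ∈-map⁻ orient e₁∈ | ∈-map⁻ orient e₂∈ | find joined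
      ... | _ , p∈ , refl | _ , q∈ , refl | _ , e∈ , e≢e₁ , e≢e₂ , j =
        Sum.[ e≢e₁ , e≢e₂ ] (joins⇒≡ p∈ q∈ e∈ j)

  open FromStarForest public using (length≤ρᵉᵒ)

  -- From edge open packing sets to star forests.

  module ToStarForest {B : List Dart} (B⊆ : B ⊆ edges G)
    (packing : ∀ {e₁ e₂} → e₁ ∈ B → e₂ ∈ B → e₁ ≢ e₂ →
      ¬ Any (λ e → e ≢ e₁ × e ≢ e₂ × Joins G e e₁ e₂) (edges G))
    where

    -- Otherwise the edge between `u` and `v` would be a third edge joining `e` to `f`, which the
    -- packing forbids.
    adjacent-ends : ∀ {e f u v} → e ∈ B → f ∈ B → e ≢ f → EndOf G u e → EndOf G v f → u ~ v →
      (u , v) ≈ˢ e ⊎ (u , v) ≈ˢ f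
    adjacent-ends {e} {f} e∈ f∈ e≢f u v u~v with ~⇒edge u~v
    ... | g , g∈ , s with g ≟ᵈ e | g ≟ᵈ f
    ...   | yes refl | _        = inj₁ (≈ˢ-sym s)
    ...   | no _     | yes refl = inj₂ (≈ˢ-sym s)
    ...   | no g≢e   | no g≢f   =
      contradiction (lose g∈ (g≢e , g≢f , joins s)) (packing e∈ f∈ e≢f)
      where
      joins : g ≈ˢ _ → Joins G g e f
      joins (inj₁ refl) = inj₁ (u , v)
      joins (inj₂ refl) = inj₂ (u , v)

    SharedBy : Dart → U.Pred Dart 0ℓ
    SharedBy e f = f ≢ e × EndOf G (proj₁ e) f

    sharedBy? : ∀ e → U.Decidable (SharedBy e)
    sharedBy? e f = ¬? (f ≟ᵈ e) ×-dec endOf? G (proj₁ e) f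

    -- An end shared with another edge of B is the centre of its star.
    dart : Dart → Dart
    dart e with any? (sharedBy? e) B
    ... | yes _ = swap e
    ... | no  _ = e

    dart-≈ˢ : ∀ e → dart e ≈ˢ e
    dart-≈ˢ e with any? (sharedBy? e) B
    ... | yes _ = inj₂ refl
    ... | no  _ = inj₁ refl

    edge-ends : ∀ {e f} → e ∈ B → f ∈ B → EndOf G (proj₁ e) f → EndOf G (proj₂ e) f → e ≡ f
    edge-ends e∈ f∈ u v = ≈ˢ-edges⇒≡ (B⊆ e∈) (B⊆ f∈) (ends⇒≈ˢ (~⇒≢ (edge⇒~ (B⊆ e∈))) u v)

    -- If the first end of `e` is unshared, it is the leaf and the claim is immediate. If `f′`
    -- shares it, the leaf is the second end. An `f` containing that end is either `f′`, which then
    -- has both ends of `e`, or else `e` joins `f′` to `f` and must be one of them.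
    leaf-private : ∀ {e f} → e ∈ B → f ∈ B → f ≢ e → ¬ EndOf G (proj₁ (dart e)) f
    leaf-private {e} {f} e∈ f∈ f≢e end with any? (sharedBy? e) B
    ... | no ¬shared = ¬shared (lose f∈ (f≢e , end))
    ... | yes shared with find shared
    ...   | f′ , f′∈ , f′≢e , end′ with f′ ≟ᵈ f
    ...     | yes refl = f≢e (sym (edge-ends e∈ f∈ end′ end))
    ...     | no f′≢f with adjacent-ends f′∈ f∈ f′≢f end′ end (edge⇒~ (B⊆ e∈))
    ...       | inj₁ s = f′≢e (sym (≈ˢ-edges⇒≡ (B⊆ e∈) (B⊆ f′∈) s))
    ...       | inj₂ s = f≢e (sym (≈ˢ-edges⇒≡ (B⊆ e∈) (B⊆ f∈) s))

    leaf-end : ∀ e → EndOf G (proj₁ (dart e)) e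
    leaf-end e = EndOf-≈ˢ (dart-≈ˢ e) (inj₁ refl)

    centre-end : ∀ e → EndOf G (proj₂ (dart e)) e
    centre-end e = EndOf-≈ˢ (dart-≈ˢ e) (inj₂ refl)

    dart-spoke : ∀ {e} → e ∈ B → proj₁ (dart e) ~ proj₂ (dart e)
    dart-spoke {e} e∈ with dart e | dart-≈ˢ e
    ... | _ | inj₁ refl = edge⇒~ (B⊆ e∈)
    ... | _ | inj₂ refl = ~-sym (edge⇒~ (B⊆ e∈))

    dart-injective : ∀ {e f} → e ∈ B → f ∈ B → dart e ≡ dart f → e ≡ f
    dart-injective {e} {f} e∈ f∈ eq = ≈ˢ-edges⇒≡ (B⊆ e∈) (B⊆ f∈)
      (≈ˢ-trans (≈ˢ-sym (dart-≈ˢ e)) (subst (_≈ˢ f) (sym eq) (dart-≈ˢ f)))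

    -- Adjacent leaves would form `e` or `f`, so the leaf of one edge would be an end of the other.
    dart-leaves : ∀ {e f} → e ∈ B → f ∈ B → ¬ (proj₁ (dart e) ~ proj₁ (dart f))
    dart-leaves {e} {f} e∈ f∈ u~v with e ≟ᵈ f
    ... | yes refl = ~-irrefl u~v
    ... | no  e≢f with adjacent-ends e∈ f∈ e≢f (leaf-end e) (leaf-end f) u~v
    ...   | inj₁ s = leaf-private f∈ e∈ e≢f (EndOf-≈ˢ s (inj₂ refl))
    ...   | inj₂ s = leaf-private e∈ f∈ (e≢f ∘ sym) (EndOf-≈ˢ s (inj₁ refl))

    -- A pair of centres that is an edge e would contain the leaf of e.
    centres-not-edge : ∀ {e f} → e ∈ B → f ∈ B → e ≢ f → ¬ ((proj₂ (dart e) , proj₂ (dart f)) ≈ˢ e)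
    centres-not-edge {e} {f} e∈ f∈ e≢f s with EndOf-≈ˢ (≈ˢ-sym s) (leaf-end e)
    ... | inj₁ leaf≡ = ~⇒≢ (dart-spoke e∈) leaf≡
    ... | inj₂ leaf≡ = leaf-private e∈ f∈ (e≢f ∘ sym)
      (subst (λ w → EndOf G w f) (sym leaf≡) (centre-end f))

    dart-centres : ∀ {e f} → e ∈ B → f ∈ B → ¬ (proj₂ (dart e) ~ proj₂ (dart f))
    dart-centres {e} {f} e∈ f∈ u~v with e ≟ᵈ f
    ... | yes refl = ~-irrefl u~v
    ... | no  e≢f with adjacent-ends e∈ f∈ e≢f (centre-end e) (centre-end f) u~v
    ...   | inj₁ s = centres-not-edge e∈ f∈ e≢f s
    ...   | inj₂ s = centres-not-edge f∈ e∈ (e≢f ∘ sym) (≈ˢ-swapˡ s)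

    -- For distinct edges the adjacent pair is `e` or `f`. It is not `f`, since the leaf of `e` is
    -- private; in `e`, the end other than the leaf is the centre.
    dart-spoke⇒centre : ∀ {e f} → e ∈ B → f ∈ B → proj₁ (dart e) ~ proj₂ (dart f) →
      proj₂ (dart e) ≡ proj₂ (dart f)
    dart-spoke⇒centre {e} {f} e∈ f∈ u~v with e ≟ᵈ f
    ... | yes refl = refl
    ... | no  e≢f with adjacent-ends e∈ f∈ e≢f (leaf-end e) (centre-end f) u~v
    ...   | inj₂ s = contradiction (EndOf-≈ˢ s (inj₁ refl)) (leaf-private e∈ f∈ (e≢f ∘ sym))
    ...   | inj₁ s with EndOf-≈ˢ (≈ˢ-sym s) (centre-end e)
    ...     | inj₁ centre≡leaf = contradiction (sym centre≡leaf) (~⇒≢ (dart-spoke e∈))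
    ...     | inj₂ centre≡     = centre≡

    starForest : StarForest (map dart B)
    starForest = record
      { spoke        = λ p∈ → ∈-map-elim dart-spoke p∈
      ; leaves       = λ p∈ q∈ → ∈-map-elim₂ dart-leaves p∈ q∈
      ; centres      = λ p∈ q∈ → ∈-map-elim₂ dart-centres p∈ q∈
      ; spoke⇒centre = λ p∈ q∈ → ∈-map-elim₂ dart-spoke⇒centre p∈ q∈
      }

  ρᵉᵒ-attained : ∃ λ D → Unique D × StarForest D × length D ≡ ρᵉᵒ G
  ρᵉᵒ-attained with maxCardinality-attained (edgeOpenPacking? G) edges-Unique
  ... | B , uB , B⊆ , packing , eq =
    map dart B , Unique-map⁺ dart-injective uB , starForest , trans (length-map dart B) eq
    where open ToStarForest B⊆ packing

  -- The leaves of a maximum star forest are distinct and independent.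
  ρᵉᵒ≤α : ρᵉᵒ G ℕ.≤ α G
  ρᵉᵒ≤α with ρᵉᵒ-attained
  ... | D , uD , F , eq = subst (ℕ._≤ α G) (trans (length-map proj₁ D) eq)
    (length≤α (Unique-map⁺ (StarForest.leaf-injective F) uD)
      (λ u∈ v∈ → ∈-map-elim₂ (StarForest.leaves F) u∈ v∈))

-- Lexicographic products

length-cartesianProduct : (xs : List A) (ys : List B) →
  length (cartesianProduct xs ys) ≡ length xs ℕ.* length ys
length-cartesianProduct []       ys = refl
length-cartesianProduct (x ∷ xs) ys = trans (length-++ (map (x ,_) ys))
  (cong₂ ℕ._+_ (length-map (x ,_) ys) (length-cartesianProduct xs ys))

-- At most `(ρ ∸ k) + (a ∸ ρ)` terms have weight `r`; raising the weight of `ρ ∸ k` of them to `a′`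
-- does not decrease the sum.
exchange-≤ : ∀ {k m ρ a a′ r} → k ℕ.≤ ρ → k ℕ.+ m ℕ.≤ a → ρ ℕ.≤ a → r ℕ.≤ a′ →
  k ℕ.* a′ ℕ.+ m ℕ.* r ℕ.≤ ρ ℕ.* a′ ℕ.+ r ℕ.* (a ∸ ρ)
exchange-≤ {k} {m} {ρ} {a} {a′} {r} k≤ρ k+m≤a ρ≤a r≤a′ = begin
  k ℕ.* a′ ℕ.+ m ℕ.* r
    ≤⟨ ℕ.+-monoʳ-≤ (k ℕ.* a′) (ℕ.*-monoˡ-≤ r m≤) ⟩
  k ℕ.* a′ ℕ.+ ((ρ ∸ k) ℕ.+ (a ∸ ρ)) ℕ.* r
    ≡⟨ cong (k ℕ.* a′ ℕ.+_) (ℕ.*-distribʳ-+ r (ρ ∸ k) (a ∸ ρ)) ⟩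
  k ℕ.* a′ ℕ.+ ((ρ ∸ k) ℕ.* r ℕ.+ (a ∸ ρ) ℕ.* r)
    ≤⟨ ℕ.+-monoʳ-≤ (k ℕ.* a′) (ℕ.+-monoˡ-≤ _ (ℕ.*-monoʳ-≤ (ρ ∸ k) r≤a′)) ⟩
  k ℕ.* a′ ℕ.+ ((ρ ∸ k) ℕ.* a′ ℕ.+ (a ∸ ρ) ℕ.* r)
    ≡⟨ ℕ.+-assoc (k ℕ.* a′) _ _ ⟨
  k ℕ.* a′ ℕ.+ (ρ ∸ k) ℕ.* a′ ℕ.+ (a ∸ ρ) ℕ.* r
    ≡⟨ cong₂ ℕ._+_ (ℕ.*-distribʳ-+ a′ k (ρ ∸ k)) (ℕ.*-comm r (a ∸ ρ)) ⟨
  (k ℕ.+ (ρ ∸ k)) ℕ.* a′ ℕ.+ r ℕ.* (a ∸ ρ)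
    ≡⟨ cong (λ n → n ℕ.* a′ ℕ.+ r ℕ.* (a ∸ ρ)) (ℕ.m+[n∸m]≡n k≤ρ) ⟩
  ρ ℕ.* a′ ℕ.+ r ℕ.* (a ∸ ρ) ∎
  where
  open ℕ.≤-Reasoning
  m≤ : m ℕ.≤ (ρ ∸ k) ℕ.+ (a ∸ ρ)
  m≤ = ℕ.+-cancelˡ-≤ k _ _ (begin
    k ℕ.+ m                      ≤⟨ k+m≤a ⟩
    a                            ≡⟨ ℕ.m+[n∸m]≡n ρ≤a ⟨
    ρ ℕ.+ (a ∸ ρ)                ≡⟨ cong (ℕ._+ (a ∸ ρ)) (ℕ.m+[n∸m]≡n k≤ρ) ⟨
    k ℕ.+ (ρ ∸ k) ℕ.+ (a ∸ ρ)    ≡⟨ ℕ.+-assoc k _ _ ⟩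
    k ℕ.+ ((ρ ∸ k) ℕ.+ (a ∸ ρ))  ∎)

module _ (G H : Graph) where
  private
    module G = Graph G
    module H = Graph H
    module GH = Graph (G ∘ˡ H)

  -- The lower bound: lifting star forests of `G`.

  module Lift {D : List (Dart G)} {I : List H.Vertex} (uD : Unique D) (F : StarForest G D)
    (uI : Unique I) (ind : ∀ {h h′} → h ∈ I → h′ ∈ I → ¬ (h H.~ h′)) {h₀} (h₀∈ : h₀ ∈ I)
    where
    open StarForest F

    -- Leaves are copied over all of `I`, while every centre sits on the one level `h₀`, so each
    -- star of `G` remains a single star.
    lift : Dart G × H.Vertex → Dart (G ∘ˡ H)
    lift ((l , c) , h) = (l , h) , (c , h₀)

    lift-injective : ∀ {x y} → lift x ≡ lift y → x ≡ y
    lift-injective refl = refl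

    from-× : ∀ {x} → x ∈ cartesianProduct D I → proj₁ x ∈ D × proj₂ x ∈ I
    from-× = ∈-cartesianProduct⁻ D I

    liftedSpoke : ∀ {x} → x ∈ cartesianProduct D I → proj₁ (lift x) GH.~ proj₂ (lift x)
    liftedSpoke x∈ = inj₁ (spoke (proj₁ (from-× x∈)))

    liftedLeaves : ∀ {x y} → x ∈ cartesianProduct D I → y ∈ cartesianProduct D I →
      ¬ (proj₁ (lift x) GH.~ proj₁ (lift y))
    liftedLeaves x∈ y∈ with from-× x∈ | from-× y∈
    ... | p∈ , h∈ | q∈ , h′∈ = Sum.[ leaves p∈ q∈ , ind h∈ h′∈ ∘ proj₂ ]

    liftedCentres : ∀ {x y} → x ∈ cartesianProduct D I → y ∈ cartesianProduct D I →
      ¬ (proj₂ (lift x) GH.~ proj₂ (lift y))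
    liftedCentres x∈ y∈ with from-× x∈ | from-× y∈
    ... | p∈ , _ | q∈ , _ = Sum.[ centres p∈ q∈ , H.~-irrefl ∘ proj₂ ]

    liftedSpoke⇒centre : ∀ {x y} → x ∈ cartesianProduct D I → y ∈ cartesianProduct D I →
      proj₁ (lift x) GH.~ proj₂ (lift y) → proj₂ (lift x) ≡ proj₂ (lift y)
    liftedSpoke⇒centre x∈ y∈ with from-× x∈ | from-× y∈
    ... | p∈ , h∈ | q∈ , _ = Sum.[ cong (_, h₀) ∘ spoke⇒centre p∈ q∈
                                  -- Within one copy of `H`, adjacency would contradict the
                                  -- independence of `I`, which contains `h₀`.
                                  , (λ (_ , h~h₀) → contradiction h~h₀ (ind h∈ h₀∈)) ]

    lifted : StarForest (G ∘ˡ H) (map lift (cartesianProduct D I))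
    lifted = record
      { spoke        = λ p∈ → ∈-map-elim liftedSpoke p∈
      ; leaves       = λ p∈ q∈ → ∈-map-elim₂ liftedLeaves p∈ q∈
      ; centres      = λ p∈ q∈ → ∈-map-elim₂ liftedCentres p∈ q∈
      ; spoke⇒centre = λ p∈ q∈ → ∈-map-elim₂ liftedSpoke⇒centre p∈ q∈
      }

    length-*≤ρᵉᵒ : length D ℕ.* length I ℕ.≤ ρᵉᵒ (G ∘ˡ H)
    length-*≤ρᵉᵒ = subst (ℕ._≤ ρᵉᵒ (G ∘ˡ H))
      (trans (length-map lift (cartesianProduct D I)) (length-cartesianProduct D I))
      (length≤ρᵉᵒ (G ∘ˡ H) (map⁺ lift-injective (cartesianProduct⁺ uD uI)) lifted)

  ρᵉᵒ*α≤ρᵉᵒ-∘ˡ : ρᵉᵒ G ℕ.* α H ℕ.≤ ρᵉᵒ (G ∘ˡ H)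
  ρᵉᵒ*α≤ρᵉᵒ-∘ˡ with ρᵉᵒ-attained G | α-attained H
  -- Here `α H` is 0 and no level `h₀` is available, but the left side vanishes.
  ... | D , uD , F , eqD | [] , uI , ind , eqI =
    subst (λ n → ρᵉᵒ G ℕ.* n ℕ.≤ ρᵉᵒ (G ∘ˡ H)) eqI
      (subst (ℕ._≤ ρᵉᵒ (G ∘ˡ H)) (sym (ℕ.*-zeroʳ (ρᵉᵒ G))) z≤n)
  ... | D , uD , F , eqD | h₀ ∷ I , uI , ind , eqI =
    subst₂ (λ m n → m ℕ.* n ℕ.≤ ρᵉᵒ (G ∘ˡ H)) eqD eqI
      (Lift.length-*≤ρᵉᵒ uD F uI ind (here refl))

  -- The upper bound: projecting star forests of the product.

  module Project {D : List (Dart (G ∘ˡ H))} (uD : Unique D) (F : StarForest (G ∘ˡ H) D) where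
    open StarForest F

    onG : Dart (G ∘ˡ H) → Dart G
    onG ((g , _) , (g′ , _)) = g , g′

    onH : Dart (G ∘ˡ H) → Dart H
    onH ((_ , h) , (_ , h′)) = h , h′

    -- A spoke of the product projects either to an edge of `G`, the proper case, or to a degenerate
    -- pair with equal entries.
    Proper : U.Pred (Dart G) 0ℓ
    Proper (g , g′) = g G.~ g′

    proper? : U.Decidable Proper
    proper? (g , g′) = g G.~? g′

    over : Dart G → List (Dart (G ∘ˡ H))
    over = fibre (_≟ᵈ_ G) onG D

    over⁻ : ∀ {d p} → p ∈ over d → p ∈ D × onG p ≡ d
    over⁻ = ∈-filter⁻ (λ p → _≟ᵈ_ G (onG p) _) {xs = D}

    -- Leaves over `d` lie in one copy of `H`, where they are distinct and independent.
    length-over≤α : ∀ {d} → length (over d) ℕ.≤ α H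
    length-over≤α {d} = subst (ℕ._≤ α H) (length-map _ (over d))
      (length≤α H (Unique-map⁺ injective (filter⁺ _ uD)) (λ u∈ v∈ → ∈-map-elim₂ independent u∈ v∈))
      where
      injective : ∀ {p q} → p ∈ over d → q ∈ over d → proj₁ (onH p) ≡ proj₁ (onH q) → p ≡ q
      injective p∈ q∈ eq with over⁻ p∈ | over⁻ q∈
      ... | p∈D , refl | q∈D , eq′ = leaf-injective p∈D q∈D (cong₂ _,_ (cong proj₁ (sym eq′)) eq)

      independent : ∀ {p q} → p ∈ over d → q ∈ over d → ¬ (proj₁ (onH p) H.~ proj₁ (onH q))
      independent p∈ q∈ h~h′ with over⁻ p∈ | over⁻ q∈
      ... | p∈D , refl | q∈D , eq′ = leaves p∈D q∈D (inj₂ (cong proj₁ (sym eq′) , h~h′))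

    -- When `d` is not an edge, all darts over it lie inside one copy of `H` and form a star forest
    -- there.
    length-over≤ρᵉᵒ : ∀ {d} → ¬ Proper d → length (over d) ℕ.≤ ρᵉᵒ H
    length-over≤ρᵉᵒ {d} ¬proper = subst (ℕ._≤ ρᵉᵒ H) (length-map onH (over d))
      (length≤ρᵉᵒ H (Unique-map⁺ injective (filter⁺ _ uD)) record
        { spoke        = λ p∈ → ∈-map-elim (λ r∈ → proj₂ (spokeH r∈)) p∈
        ; leaves       = λ p∈ q∈ → ∈-map-elim₂ leavesH p∈ q∈
        ; centres      = λ p∈ q∈ → ∈-map-elim₂ centresH p∈ q∈
        ; spoke⇒centre = λ p∈ q∈ → ∈-map-elim₂ spoke⇒centreH p∈ q∈
        })
      where
      injective : ∀ {p q} → p ∈ over d → q ∈ over d → onH p ≡ onH q → p ≡ q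
      injective p∈ q∈ refl with over⁻ p∈ | over⁻ q∈
      ... | _ , refl | _ , refl = refl

      -- The equality of the ends of `d` lets `spoke⇒centreH` turn an adjacency of leaf and centre
      -- in `H` into one in the product.
      spokeH : ∀ {p} → p ∈ over d → proj₁ d ≡ proj₂ d × proj₁ (onH p) H.~ proj₂ (onH p)
      spokeH p∈ with over⁻ p∈
      ... | p∈D , refl with spoke p∈D
      ...   | inj₁ proper = contradiction proper ¬proper
      ...   | inj₂ spoke′ = spoke′

      leavesH : ∀ {p q} → p ∈ over d → q ∈ over d → ¬ (proj₁ (onH p) H.~ proj₁ (onH q))
      leavesH p∈ q∈ h~h′ with over⁻ p∈ | over⁻ q∈
      ... | p∈D , refl | q∈D , refl = leaves p∈D q∈D (inj₂ (refl , h~h′))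

      centresH : ∀ {p q} → p ∈ over d → q ∈ over d → ¬ (proj₂ (onH p) H.~ proj₂ (onH q))
      centresH p∈ q∈ h~h′ with over⁻ p∈ | over⁻ q∈
      ... | p∈D , refl | q∈D , refl = centres p∈D q∈D (inj₂ (refl , h~h′))

      spoke⇒centreH : ∀ {p q} → p ∈ over d → q ∈ over d →
        proj₁ (onH p) H.~ proj₂ (onH q) → proj₂ (onH p) ≡ proj₂ (onH q)
      spoke⇒centreH p∈ q∈ h~h′ with over⁻ p∈ | over⁻ q∈ | spokeH p∈
      ... | p∈D , refl | q∈D , refl | g≡g′ , _ =
        cong proj₂ (spoke⇒centre p∈D q∈D (inj₂ (g≡g′ , h~h′)))

    projections : List (Dart G)
    projections = deduplicate (_≟ᵈ_ G) (map onG D)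

    projections-Unique : Unique projections
    projections-Unique = DecUnique.deduplicate-! (_≟ᵈ_ G) (map onG D)

    ∈-projections⁺ : ∀ {p} → p ∈ D → onG p ∈ projections
    ∈-projections⁺ p∈ = ∈-deduplicate⁺ (_≟ᵈ_ G) (∈-map⁺ onG p∈)

    ∈-projections⁻ : ∀ {d} → d ∈ projections → d ∈ map onG D
    ∈-projections⁻ = ∈-deduplicate⁻ (_≟ᵈ_ G) (map onG D)

    -- An edge of `G` makes its two copies of `H` completely adjacent, so the leaf of `q` also sees
    -- the centre of `p`.
    proper-onG : ∀ {p q} → p ∈ D → q ∈ D → proj₁ (onG p) ≡ proj₁ (onG q) →
      Proper (onG p) → onG p ≡ onG q
    proper-onG p∈ q∈ refl proper =
      cong (λ c → _ , proj₁ c) (sym (spoke⇒centre q∈ p∈ (inj₁ proper)))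

    onG-leaf : ∀ {p q} → p ∈ D → q ∈ D → proj₁ (onG p) ≡ proj₁ (onG q) → onG p ≡ onG q
    onG-leaf p∈ q∈ eq with spoke p∈ | spoke q∈
    ... | inj₁ proper     | _               = proper-onG p∈ q∈ eq proper
    ... | inj₂ _          | inj₁ proper     = sym (proper-onG q∈ p∈ (sym eq) proper)
    ... | inj₂ (refl , _) | inj₂ (refl , _) = cong₂ _,_ eq eq

    -- By `onG-leaf` a projection is determined by its leaf, so proper and degenerate ones are
    -- counted together by an independent set of leaves.
    length-projections : length projections ℕ.≤ α G
    length-projections = subst (ℕ._≤ α G) (length-map proj₁ projections)
      (length≤α G
        (Unique-map⁺ (λ d∈ d′∈ → ∈-map-elim₂ onG-leaf (∈-projections⁻ d∈) (∈-projections⁻ d′∈))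
          projections-Unique)
        (λ u∈ v∈ → ∈-map-elim₂ (λ d∈ d′∈ →
          ∈-map-elim₂ {R = λ d d′ → ¬ (proj₁ d G.~ proj₁ d′)} (λ p∈ q∈ → leaves p∈ q∈ ∘ inj₁)
            (∈-projections⁻ d∈) (∈-projections⁻ d′∈)) u∈ v∈))

    proper-projections : List (Dart G)
    proper-projections = filter proper? projections

    -- An adjacency in `G` between projected ends holds in the product at every level, so the
    -- conditions on `D` descend to `G`.
    length-proper-projections : length proper-projections ℕ.≤ ρᵉᵒ G
    length-proper-projections = length≤ρᵉᵒ G (filter⁺ proper? projections-Unique) record
      { spoke        = λ d∈ → proj₂ (∈-filter⁻ proper? {xs = projections} d∈)
      ; leaves       = λ d∈ d′∈ → ∈-map-elim₂ {R = λ d d′ → ¬ (proj₁ d G.~ proj₁ d′)}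
          (λ p∈ q∈ → leaves p∈ q∈ ∘ inj₁) (project d∈) (project d′∈)
      ; centres      = λ d∈ d′∈ → ∈-map-elim₂ {R = λ d d′ → ¬ (proj₂ d G.~ proj₂ d′)}
          (λ p∈ q∈ → centres p∈ q∈ ∘ inj₁) (project d∈) (project d′∈)
      ; spoke⇒centre = λ d∈ d′∈ → ∈-map-elim₂ {R = λ d d′ → proj₁ d G.~ proj₂ d′ → proj₂ d ≡ proj₂ d′}
          (λ p∈ q∈ → cong proj₁ ∘ spoke⇒centre p∈ q∈ ∘ inj₁) (project d∈) (project d′∈)
      }
      where
      project : ∀ {d} → d ∈ proper-projections → d ∈ map onG D
      project = ∈-projections⁻ ∘ proj₁ ∘ ∈-filter⁻ proper? {xs = projections}

    degenerate-projections : List (Dart G)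
    degenerate-projections = filter (¬? ∘ proper?) projections

    length-D : length D ℕ.≤
      length proper-projections ℕ.* α H ℕ.+ length degenerate-projections ℕ.* ρᵉᵒ H
    length-D = length≤fibres (_≟ᵈ_ G) onG proper? uD ∈-projections⁺
      (λ _ → length-over≤α) length-over≤ρᵉᵒ

    length-both : length proper-projections ℕ.+ length degenerate-projections ℕ.≤ α G
    length-both = subst (ℕ._≤ α G) (sym (length-filter-∁ proper? projections)) length-projections

  ρᵉᵒ-∘ˡ≤ : ρᵉᵒ (G ∘ˡ H) ℕ.≤ ρᵉᵒ G ℕ.* α H ℕ.+ ρᵉᵒ H ℕ.* (α G ∸ ρᵉᵒ G)
  ρᵉᵒ-∘ˡ≤ with ρᵉᵒ-attained (G ∘ˡ H)
  ... | D , uD , F , eq = begin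
    ρᵉᵒ (G ∘ˡ H)                           ≡⟨ eq ⟨
    length D                               ≤⟨ length-D ⟩
    k ℕ.* α H ℕ.+ m ℕ.* ρᵉᵒ H
      ≤⟨ exchange-≤ length-proper-projections length-both (ρᵉᵒ≤α G) (ρᵉᵒ≤α H) ⟩
    ρᵉᵒ G ℕ.* α H ℕ.+ ρᵉᵒ H ℕ.* (α G ∸ ρᵉᵒ G) ∎
    where
    open Project uD F
    open ℕ.≤-Reasoning
    k = length proper-projections
    m = length degenerate-projections

-- Sharpness, and the bounds over the integers.

K₂ : Graph
K₂ = record
  { Vertex   = Bool
  ; vertices = false ∷ true ∷ []
  ; unique   = ((λ ()) ∷ []) ∷ [] ∷ []
  ; complete = λ { false → here refl ; true → there (here refl) }
  ; _≟_      = Bool._≟_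
  ; _~_      = _≢_
  ; _~?_     = λ u v → ¬? (u Bool.≟ v)
  ; ~-sym    = λ u≢v → u≢v ∘ sym
  ; ~-irrefl = λ u≢u → u≢u refl
  }

theorem3p2 : ((G H : Graph) →
    (+ ρᵉᵒ G * + α H ≤ + ρᵉᵒ (G ∘ˡ H)) ×
    (+ ρᵉᵒ (G ∘ˡ H) ≤ + ρᵉᵒ G * + α H + + ρᵉᵒ H * (+ α G - + ρᵉᵒ G))) ×
    (∃₂ λ (G H : Graph) → + ρᵉᵒ G * + α H ≡ + ρᵉᵒ (G ∘ˡ H)) ×
    (∃₂ λ (G H : Graph) →
    + ρᵉᵒ (G ∘ˡ H) ≡ + ρᵉᵒ G * + α H + + ρᵉᵒ H * (+ α G - + ρᵉᵒ G))
-- `K₂ ∘ˡ K₂` is the complete graph on four vertices, where any two edges are joined by a third;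
-- both bounds evaluate to 1.
theorem3p2 = (λ G H → lower G H , upper G H) , (K₂ , K₂ , refl) , (K₂ , K₂ , refl)
  where
  lower : ∀ G H → + ρᵉᵒ G * + α H ≤ + ρᵉᵒ (G ∘ˡ H)
  lower G H = subst (_≤ + ρᵉᵒ (G ∘ˡ H)) (ℤ.pos-* (ρᵉᵒ G) (α H)) (ℤ.+≤+ (ρᵉᵒ*α≤ρᵉᵒ-∘ˡ G H))

  upper : ∀ G H → + ρᵉᵒ (G ∘ˡ H) ≤ + ρᵉᵒ G * + α H + + ρᵉᵒ H * (+ α G - + ρᵉᵒ G)
  upper G H = subst (+ ρᵉᵒ (G ∘ˡ H) ≤_) cast (ℤ.+≤+ (ρᵉᵒ-∘ˡ≤ G H))
    where
    -- By `ρᵉᵒ≤α` the truncated difference agrees with the integer one.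
    cast : + (ρᵉᵒ G ℕ.* α H ℕ.+ ρᵉᵒ H ℕ.* (α G ∸ ρᵉᵒ G)) ≡
      + ρᵉᵒ G * + α H + + ρᵉᵒ H * (+ α G - + ρᵉᵒ G)
    cast = trans (ℤ.pos-+ (ρᵉᵒ G ℕ.* α H) _)
      (cong₂ _+_ (ℤ.pos-* (ρᵉᵒ G) (α H))
        (trans (ℤ.pos-* (ρᵉᵒ H) _) (cong (+ ρᵉᵒ H *_)
          (sym (trans (ℤ.m-n≡m⊖n (α G) (ρᵉᵒ G)) (ℤ.⊖-≥ (ρᵉᵒ≤α G)))))))
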